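{- Let $a,b,c \ge 1$ be integers. Then $$\sum_{\pi \in \mathrm{PP}(a,b,c)} q^{|\pi|} t^{\mathrm{tr}(\pi)} = \sum_{\pi \in \mathrm{PP}(a,b,c)} q^{|\pi|_{ch}} t^{\mathrm{cor}(\pi)}.$$ Equivalently, for all integers $n,k$, $$|\{\pi \in \mathrm{PP}(a,b,c) : |\pi| = n,\ \mathrm{tr}(\pi) = k\}| = |\{\pi \in \mathrm{PP}(a,b,c) : |\pi|_{ch} = n,\ \mathrm{cor}(\pi) = k\}|.$$
   Context: A plane partition is a matrix $\pi=(\pi_{i,j})_{i,j\ge1}$ of nonnegative integers with finitely many nonzero entries such that $\pi_{i,j}\ge\pi_{i+1,j}$ and $\pi_{i,j}\ge\pi_{i,j+1}$ for all $i,j\ge1$. Its diagram is $D(\pi)=\{(i,j,k)\in\mathbb{Z}_{\ge1}^3 : 1\le k\le \pi_{i,j}\}$. The set of corners is $\mathrm{Cor}(\pi)=\{(i,j,k)\in D(\pi) : (i+1,j,k)\notin D(\pi),\ (i,j+1,k)\notin D(\pi)\}$ and $\mathrm{cor}(\pi)=|\mathrm{Cor}(\pi)|$. The volume is $|\pi|=\sum_{i,j}\pi_{i,j}$, the trace is $\mathrm{tr}(\pi)=\sum_i \pi_{i,i}$, and the corner-hook volume is $|\pi|_{ch}=\sum_{(i,j,k)\in\mathrm{Cor}(\pi)}(i+j-1)$. For $n\in\mathbb{N}$ write $[n]=\{1,\dots,n\}$; $\mathrm{PP}(a,b,c)$ denotes the set of plane partitions whose diagram lies inside $[a]\times[b]\times[c]$.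 Here $q,t$ are formal variables. -}

module Defs where

open import Data.Nat using (ℕ; zero; suc; _+_; _≤_; _≤ᵇ_; _⊓_)
open import Data.Bool using (Bool; true; false; _∧_; not; if_then_else_)
open import Data.List using (List; upTo; map)
open import Data.Nat.ListAction using (sum)
open import Data.List.Relation.Unary.All using (All)
open import Data.Vec using (Vec; []; _∷_)
open import Data.Product using (Σ)

Mat : ℕ → ℕ → Set
Mat a b = Vec (Vec ℕ b) a

-- total 0-based lookup: entries outside the a × b box are 0,
-- so a matrix represents an infinite matrix supported in [a] × [b].
vget : ∀ {n} → Vec ℕ n → ℕ → ℕ
vget [] _ = 0
vget (x ∷ xs) zero = x
vget (x ∷ xs) (suc j) = vget xs j

rowget : ∀ {a b} → Mat a b → ℕ → Vec ℕ b
rowget {b = b} [] _ = Data.Vec.replicate b 0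
rowget (r ∷ rs) zero = r
rowget (r ∷ rs) (suc i) = rowget rs i

-- ent π i j = π_{i+1,j+1} (0-based indices)
ent : ∀ {a b} → Mat a b → ℕ → ℕ → ℕ
ent π i j = vget (rowget π i) j

sumTo : ℕ → (ℕ → ℕ) → ℕ
sumTo n f = sum (map f (upTo n))

-- π is a plane partition with diagram in [a] × [b] × [c]:
-- all entries ≤ c, weakly decreasing along rows and columns.
-- (Outside the box all entries are 0, so checking the box suffices.)
record IsPP {a b : ℕ} (c : ℕ) (π : Mat a b) : Set where
  field
    bounded : All (λ i → All (λ j → ent π i j ≤ c) (upTo b)) (upTo a)
    decDown : All (λ i → All (λ j → ent π (suc i) j ≤ ent π i j) (upTo b)) (upTo a)
    decRight : All (λ i → All (λ j → ent π i (suc j) ≤ ent π i j) (upTo b)) (upTo a)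

PP : ℕ → ℕ → ℕ → Set
PP a b c = Σ (Mat a b) (IsPP c)

vol : ∀ {a b} → Mat a b → ℕ
vol {a} {b} π = sumTo a (λ i → sumTo b (λ j → ent π i j))

tr : ∀ {a b} → Mat a b → ℕ
tr {a} {b} π = sumTo (a ⊓ b) (λ i → ent π i i)

-- (i+1, j+1, k) ∈ D(π), with 0-based i j and k ≥ 1
inD : ∀ {a b} → Mat a b → ℕ → ℕ → ℕ → Bool
inD π i j k = (1 ≤ᵇ k) ∧ (k ≤ᵇ ent π i j)

isCorner : ∀ {a b} → Mat a b → ℕ → ℕ → ℕ → Bool
isCorner π i j k = inD π i j k ∧ not (inD π (suc i) j k) ∧ not (inD π i (suc j) k)

-- sum of w over all corners (i+1,j+1,k) of π ∈ PP(a,b,c); the diagram lies in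
-- [a] × [b] × [c], so it suffices to range over i < a, j < b, k ∈ {1..c}.
cornerSum : ∀ {a b} → ℕ → Mat a b → (ℕ → ℕ → ℕ) → ℕ
cornerSum {a} {b} c π w =
  sumTo a (λ i → sumTo b (λ j → sumTo c (λ k →
    if isCorner π i j (suc k) then w i j else 0)))

cor : ∀ {a b} → ℕ → Mat a b → ℕ
cor c π = cornerSum c π (λ _ _ → 1)

-- |π|_ch = Σ_{(i,j,k) ∈ Cor(π)} (i + j - 1)   (1-based), = i0 + j0 + 1 (0-based)
chvol : ∀ {a b} → ℕ → Mat a b → ℕ
chvol c π = cornerSum c π (λ i j → suc (i + j))

{-# OPTIONS --safe #-}

-- Let w(i,j) = π(i,j) − max(π(i+1,j), π(i,j+1)), the number of corners of π above (i,j), so that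
-- cor(π) = Σ w(i,j) and |π|_ch = Σ (i+j−1) w(i,j), and π is the array of last passage times of w.
-- The piecewise-linear RSK correspondence inserts the cells of π from the last to the first;
-- inserting (i,j) toggles the cells (i+k,j+k), k ≥ 1, replacing an entry by
-- min(up, left) + max(down, right) − entry. Every toggle is an involution of PP(a,b,c), so the
-- composite Φ is a bijection. Because min(x,y) + max(x,y) = x + y, the diagonal sums satisfy the
-- inclusion–exclusion recursion of rectangle sums: the diagonal of Φ(π) starting at a boundary
-- cell (i,j) sums to Σ w(x,y) over x ≥ i, y ≥ j. For the main diagonal this is tr(Φ(π)) = cor(π),
-- and, since w(x,y) is counted by x+y−1 diagonals, summing all of them gives |Φ(π)| = |π|_ch.
module Submission where

open import Defs
open import Data.Bool using (true; false; if_then_else_; _∧_; not)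
open import Data.Fin using (toℕ)
open import Data.List using (applyUpTo; upTo)
open import Data.List.Properties using (map-applyUpTo)
open import Data.List.Relation.Unary.All as All using (All)
open import Data.List.Relation.Unary.All.Properties using (applyUpTo⁺₂; applyUpTo⁻)
open import Data.Nat using (ℕ; zero; suc; _+_; _*_; _∸_; _≤_; _≤ᵇ_; _⊓_; _⊔_; z≤n; s≤s; s≤s⁻¹)
open import Data.Nat.ListAction using (sum)
open import Data.Nat.Properties
open import Data.Nat.Tactic.RingSolver using (solve-∀)
open import Data.Product using (Σ; _×_; _,_; proj₁)
open import Data.Sum using (inj₁; inj₂)
open import Data.Vec using (Vec; []; _∷_; tabulate; replicate)
open import Function using (_∘_; id)
open import Function.Bundles using (_↔_; mk↔ₛ′)
open import Relation.Binary.PropositionalEquality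
open import Relation.Nullary using (yes; no; does)
open import Relation.Nullary.Decidable using (dec-true; dec-false)
open import Algebra.Properties.CommutativeSemigroup +-commutativeSemigroup using (interchange)
open ≡-Reasoning

-- Finite sums.

∑ : ℕ → (ℕ → ℕ) → ℕ
∑ n f = sum (applyUpTo f n)

sumTo≡∑ : ∀ n f → sumTo n f ≡ ∑ n f
sumTo≡∑ n f = cong sum (map-applyUpTo id f n)

∑-cong : ∀ n {f g} → (∀ i → f i ≡ g i) → ∑ n f ≡ ∑ n g
∑-cong zero    f≗g = refl
∑-cong (suc n) f≗g = cong₂ _+_ (f≗g 0) (∑-cong n (f≗g ∘ suc))

∑-zero : ∀ n {f} → (∀ i → f i ≡ 0) → ∑ n f ≡ 0
∑-zero zero    f≗0 = refl
∑-zero (suc n) f≗0 = cong₂ _+_ (f≗0 0) (∑-zero n (f≗0 ∘ suc))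

∑-+ : ∀ n f g → ∑ n (λ i → f i + g i) ≡ ∑ n f + ∑ n g
∑-+ zero    f g = refl
∑-+ (suc n) f g = begin
  f 0 + g 0 + ∑ n (λ i → f (suc i) + g (suc i)) ≡⟨ cong (f 0 + g 0 +_) (∑-+ n (f ∘ suc) (g ∘ suc)) ⟩
  f 0 + g 0 + (∑ n (f ∘ suc) + ∑ n (g ∘ suc))   ≡⟨ interchange (f 0) (g 0) _ _ ⟩
  ∑ (suc n) f + ∑ (suc n) g                     ∎

∑-last : ∀ n f → ∑ (suc n) f ≡ ∑ n f + f n
∑-last zero    f = +-identityʳ (f 0)
∑-last (suc n) f = trans (cong (f 0 +_) (∑-last n (f ∘ suc))) (sym (+-assoc (f 0) (∑ n (f ∘ suc)) (f (suc n))))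

∑-extend : ∀ {m n} f → (∀ i → m ≤ i → f i ≡ 0) → m ≤ n → ∑ n f ≡ ∑ m f
∑-extend {n = n} f f≗0 z≤n       = ∑-zero n (λ i → f≗0 i z≤n)
∑-extend         f f≗0 (s≤s m≤n) = cong (f 0 +_) (∑-extend (f ∘ suc) (λ i m≤i → f≗0 (suc i) (s≤s m≤i)) m≤n)

∑-tail : ∀ n f → f n ≡ 0 → ∑ n f ≡ f 0 + ∑ n (f ∘ suc)
∑-tail n f fn≡0 = begin
  ∑ n f                ≡⟨ +-identityʳ _ ⟨
  ∑ n f + 0            ≡⟨ cong (∑ n f +_) fn≡0 ⟨
  ∑ n f + f n          ≡⟨ ∑-last n f ⟨
  f 0 + ∑ n (f ∘ suc)  ∎

-- The window keeps its length `n` when it moves one place, because the entry that comes in is zero.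
∑-shift : ∀ n q v → v (n + q) ≡ 0 → ∑ n (λ y → v (y + q)) ≡ v q + ∑ n (λ y → v (y + suc q))
∑-shift n q v v≡0 = trans (∑-tail n (λ y → v (y + q)) v≡0)
  (cong (v q +_) (∑-cong n (λ y → cong v (sym (+-suc y q)))))

-- Minima, maxima and reflections.

⊓+⊔≡+ : ∀ m n → m ⊓ n + (m ⊔ n) ≡ m + n
⊓+⊔≡+ m n with ≤-total m n
... | inj₁ m≤n = cong₂ _+_ (m≤n⇒m⊓n≡m m≤n) (m≤n⇒m⊔n≡n m≤n)
... | inj₂ n≤m = trans (cong₂ _+_ (m≥n⇒m⊓n≡n n≤m) (m≥n⇒m⊔n≡m n≤m)) (+-comm n m)

-- A toggle is the reflection of the interval from `l` to `n`; this lemma and the next keep the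
-- image inside the interval.
reflect-≤ : ∀ {l m n} → l ≤ m → n + l ∸ m ≤ n
reflect-≤ {l} {m} {n} l≤m = m≤n+o⇒m∸n≤o (n + l) m (subst (n + l ≤_) (+-comm n m) (+-monoʳ-≤ n l≤m))

≤-reflect : ∀ {l m n} → m ≤ n → l ≤ n + l ∸ m
≤-reflect {l} {m} {n} m≤n = m+n≤o⇒m≤o∸n l (subst (l + m ≤_) (+-comm l n) (+-monoʳ-≤ l m≤n))

-- Plane partitions as arrays over all cells.

Array : Set
Array = ℕ → ℕ → ℕ

infix 4 _≈_
_≈_ : Array → Array → Set
f ≈ g = ∀ x y → f x y ≡ g x y

record Fits (a b c : ℕ) (f : Array) : Set where
  field
    down  : ∀ x y → f (suc x) y ≤ f x y
    right : ∀ x y → f x (suc y) ≤ f x y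
    rows  : ∀ x y → a ≤ x → f x y ≡ 0
    cols  : ∀ x y → b ≤ y → f x y ≡ 0
    bound : ∀ x y → f x y ≤ c

open Fits

-- Toggles.

-- The new value of the cell `(suc x , suc y)`; with this indexing the upper and left neighbours
-- always exist. Adding the maximum before subtracting makes `∸` exact on arrays that fit.
toggled : Array → Array
toggled f x y = (f x (suc y) ⊓ f (suc x) y) + (f (suc (suc x)) (suc y) ⊔ f (suc x) (suc (suc y))) ∸ f (suc x) (suc y)

-- Toggles the cells (k+1, j+k+1), k ≥ 0, that is, the diagonal of (0,j) without its first cell.
T : ℕ → Array → Array
T j f zero    y       = f zero y
T j f (suc x) zero    = f (suc x) zero
T j f (suc x) (suc y) = if does (y ≟ x + j) then toggled f x y else f (suc x) (suc y)

T-on : ∀ j f {x y} → y ≡ x + j → T j f (suc x) (suc y) ≡ toggled f x y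
T-on j f {x} {y} eq rewrite dec-true (y ≟ x + j) eq = refl

T-off : ∀ j f {x y} → y ≢ x + j → T j f (suc x) (suc y) ≡ f (suc x) (suc y)
T-off j f {x} {y} neq rewrite dec-false (y ≟ x + j) neq = refl

-- The cells adjacent to a toggled cell lie on neighbouring diagonals.
T-up : ∀ j f {x y} → y ≡ x + j → T j f x (suc y) ≡ f x (suc y)
T-up j f {zero}      eq = refl
T-up j f {suc x} {y} eq = T-off j f λ eq′ → 1+n≢n (trans (sym eq) eq′)

T-left : ∀ j f {x y} → y ≡ x + j → T j f (suc x) y ≡ f (suc x) y
T-left j f {x} {zero}  eq = refl
T-left j f {x} {suc y} eq = T-off j f λ eq′ → 1+n≢n (trans eq (sym eq′))

T-down : ∀ j f {x y} → y ≡ x + j → T j f (suc (suc x)) (suc y) ≡ f (suc (suc x)) (suc y)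
T-down j f eq = T-off j f λ eq′ → 1+n≢n (trans (sym eq′) eq)

T-right : ∀ j f {x y} → y ≡ x + j → T j f (suc x) (suc (suc y)) ≡ f (suc x) (suc (suc y))
T-right j f eq = T-off j f λ eq′ → 1+n≢n (trans eq′ (sym eq))

T-cong : ∀ j {f g} → f ≈ g → T j f ≈ T j g
T-cong j f≈g zero    y       = f≈g zero y
T-cong j f≈g (suc x) zero    = f≈g (suc x) zero
T-cong j f≈g (suc x) (suc y) with does (y ≟ x + j)
... | true  = cong₂ _∸_ (cong₂ _+_ (cong₂ _⊓_ (f≈g _ _) (f≈g _ _)) (cong₂ _⊔_ (f≈g _ _) (f≈g _ _))) (f≈g _ _)
... | false = f≈g (suc x) (suc y)

module _ {a b c : ℕ} {f : Array} (F : Fits a b c f) where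

  private
    ⊔≤cell : ∀ x y → f (suc (suc x)) (suc y) ⊔ f (suc x) (suc (suc y)) ≤ f (suc x) (suc y)
    ⊔≤cell x y = ⊔-lub (down F (suc x) (suc y)) (right F (suc x) (suc y))

    cell≤⊓ : ∀ x y → f (suc x) (suc y) ≤ f x (suc y) ⊓ f (suc x) y
    cell≤⊓ x y = ⊓-glb (down F x (suc y)) (right F (suc x) y)

  -- The form of the toggle without subtraction, in which diagonal sums can be computed.
  toggled+cell : ∀ x y → toggled f x y + f (suc x) (suc y)
    ≡ (f x (suc y) ⊓ f (suc x) y) + (f (suc (suc x)) (suc y) ⊔ f (suc x) (suc (suc y)))
  toggled+cell x y = m∸n+n≡m (≤-trans (cell≤⊓ x y) (m≤m+n _ _))

  toggled≤⊓ : ∀ x y → toggled f x y ≤ f x (suc y) ⊓ f (suc x) y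
  toggled≤⊓ x y = reflect-≤ (⊔≤cell x y)

  ⊔≤toggled : ∀ x y → f (suc (suc x)) (suc y) ⊔ f (suc x) (suc (suc y)) ≤ toggled f x y
  ⊔≤toggled x y = ≤-reflect (cell≤⊓ x y)

  -- Comparing a new value with the old neighbour is enough for `T-Fits`: of two adjacent cells at
  -- most one is toggled.
  T≤up : ∀ j x y → T j f (suc x) y ≤ f x y
  T≤up j x zero    = down F x 0
  T≤up j x (suc y) with y ≟ x + j
  ... | yes eq  = ≤-trans (≤-reflexive (T-on j f eq)) (≤-trans (toggled≤⊓ x y) (m⊓n≤m _ _))
  ... | no  neq = ≤-trans (≤-reflexive (T-off j f neq)) (down F x (suc y))

  T≤left : ∀ j x y → T j f x (suc y) ≤ f x y
  T≤left j zero    y = right F 0 y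
  T≤left j (suc x) y with y ≟ x + j
  ... | yes eq  = ≤-trans (≤-reflexive (T-on j f eq)) (≤-trans (toggled≤⊓ x y) (m⊓n≤n _ _))
  ... | no  neq = ≤-trans (≤-reflexive (T-off j f neq)) (right F (suc x) y)

  T-Fits : ∀ j → Fits a b c (T j f)
  T-Fits j .down zero    y       = T≤up j 0 y
  T-Fits j .down (suc x) zero    = down F (suc x) 0
  T-Fits j .down (suc x) (suc y) with y ≟ x + j
  ... | yes eq  = subst₂ _≤_ (sym (T-down j f eq)) (sym (T-on j f eq)) (≤-trans (m≤m⊔n _ _) (⊔≤toggled x y))
  ... | no  neq = ≤-trans (T≤up j (suc x) (suc y)) (≤-reflexive (sym (T-off j f neq)))
  T-Fits j .right zero    y       = right F 0 y
  T-Fits j .right (suc x) zero    = T≤left j (suc x) 0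
  T-Fits j .right (suc x) (suc y) with y ≟ x + j
  ... | yes eq  = subst₂ _≤_ (sym (T-right j f eq)) (sym (T-on j f eq)) (≤-trans (m≤n⊔m _ _) (⊔≤toggled x y))
  ... | no  neq = ≤-trans (T≤left j (suc x) (suc y)) (≤-reflexive (sym (T-off j f neq)))
  T-Fits j .rows zero    y       le = rows F 0 y le
  T-Fits j .rows (suc x) zero    le = rows F (suc x) 0 le
  -- The left neighbour lies in the same row, so it vanishes and forces the new value to vanish; for
  -- columns the upper neighbour does this.
  T-Fits j .rows (suc x) (suc y) le = n≤0⇒n≡0 (≤-trans (T≤left j (suc x) y) (≤-reflexive (rows F (suc x) y le)))
  T-Fits j .cols zero    y       le = cols F 0 y le
  T-Fits j .cols (suc x) y       le = n≤0⇒n≡0 (≤-trans (T≤up j x y) (≤-reflexive (cols F x y le)))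
  T-Fits j .bound zero    y = bound F 0 y
  T-Fits j .bound (suc x) y = ≤-trans (T≤up j x y) (bound F x y)

  T-involutive : ∀ j → T j (T j f) ≈ f
  T-involutive j zero    y       = refl
  T-involutive j (suc x) zero    = refl
  T-involutive j (suc x) (suc y) with y ≟ x + j
  ... | no  neq = trans (T-off j (T j f) neq) (T-off j f neq)
  ... | yes eq  = begin
    T j (T j f) (suc x) (suc y) ≡⟨ T-on j (T j f) eq ⟩
    toggled (T j f) x y
      -- The four neighbours have not changed, so the second toggle reflects the same interval.
      ≡⟨ cong₂ _∸_ (cong₂ _+_ (cong₂ _⊓_ (T-up j f eq) (T-left j f eq)) (cong₂ _⊔_ (T-down j f eq) (T-right j f eq)))
                   (T-on j f eq) ⟩
    _ ∸ toggled f x y           ≡⟨ m∸[m∸n]≡n (≤-trans (cell≤⊓ x y) (m≤m+n _ _)) ⟩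
    f (suc x) (suc y)           ∎

-- Inserting one row.

-- The cells of row 0 are inserted from right to left: `T` for the largest index acts first.
sweep : ℕ → Array → Array
sweep zero    f = f
sweep (suc n) f = sweep n (T n f)

unsweep : ℕ → Array → Array
unsweep zero    f = f
unsweep (suc n) f = T n (unsweep n f)

sweep-row₀ : ∀ n f y → sweep n f 0 y ≡ f 0 y
sweep-row₀ zero    f y = refl
sweep-row₀ (suc n) f y = sweep-row₀ n (T n f) y

unsweep-row₀ : ∀ n f y → unsweep n f 0 y ≡ f 0 y
unsweep-row₀ zero    f y = refl
unsweep-row₀ (suc n) f y = unsweep-row₀ n f y

sweep-cong : ∀ n {f g} → f ≈ g → sweep n f ≈ sweep n g
sweep-cong zero    f≈g = f≈g
sweep-cong (suc n) f≈g = sweep-cong n (T-cong n f≈g)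

unsweep-cong : ∀ n {f g} → f ≈ g → unsweep n f ≈ unsweep n g
unsweep-cong zero    f≈g = f≈g
unsweep-cong (suc n) f≈g = T-cong n (unsweep-cong n f≈g)

module _ {a b c : ℕ} where

  sweep-Fits : ∀ n {f} → Fits a b c f → Fits a b c (sweep n f)
  sweep-Fits zero    F = F
  sweep-Fits (suc n) F = sweep-Fits n (T-Fits F n)

  unsweep-Fits : ∀ n {f} → Fits a b c f → Fits a b c (unsweep n f)
  unsweep-Fits zero    F = F
  unsweep-Fits (suc n) F = T-Fits (unsweep-Fits n F) n

  unsweep-sweep : ∀ n {f} → Fits a b c f → unsweep n (sweep n f) ≈ f
  unsweep-sweep zero    F x y = refl
  unsweep-sweep (suc n) F x y = trans (T-cong n (unsweep-sweep n (T-Fits F n)) x y) (T-involutive F n x y)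

  sweep-unsweep : ∀ n {f} → Fits a b c f → sweep n (unsweep n f) ≈ f
  sweep-unsweep zero    F x y = refl
  sweep-unsweep (suc n) F x y = trans (sweep-cong n (T-involutive (unsweep-Fits n F) n) x y) (sweep-unsweep n F x y)

-- The bijection on arrays.

infixr 5 _◂_
_◂_ : (ℕ → ℕ) → Array → Array
(r ◂ f) zero    = r
(r ◂ f) (suc x) = f x

◂-cong : ∀ {r s f g} → (∀ y → r y ≡ s y) → f ≈ g → (r ◂ f) ≈ (s ◂ g)
◂-cong r≗s f≈g zero    y = r≗s y
◂-cong r≗s f≈g (suc x) y = f≈g x y

tail-Fits : ∀ {a b c f} → Fits (suc a) b c f → Fits a b c (f ∘ suc)
tail-Fits F .down  x y    = down F (suc x) y
tail-Fits F .right x y    = right F (suc x) y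
tail-Fits F .rows  x y le = rows F (suc x) y (s≤s le)
tail-Fits F .cols  x y le = cols F (suc x) y le
tail-Fits F .bound x y    = bound F (suc x) y

-- Only the inequality between the first two rows involves both arrays, and there `g` agrees with
-- `f`.
◂-Fits : ∀ {a b c f g} → Fits (suc a) b c f → Fits a b c g → (∀ y → g 0 y ≡ f 1 y) → Fits (suc a) b c (f 0 ◂ g)
◂-Fits F G g₀≡f₁ .down  zero    y    = ≤-trans (≤-reflexive (g₀≡f₁ y)) (down F 0 y)
◂-Fits F G g₀≡f₁ .down  (suc x) y    = down G x y
◂-Fits F G g₀≡f₁ .right zero    y    = right F 0 y
◂-Fits F G g₀≡f₁ .right (suc x) y    = right G x y
◂-Fits F G g₀≡f₁ .rows  (suc x) y le = rows G x y (s≤s⁻¹ le)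
◂-Fits F G g₀≡f₁ .cols  zero    y le = cols F 0 y le
◂-Fits F G g₀≡f₁ .cols  (suc x) y le = cols G x y le
◂-Fits F G g₀≡f₁ .bound zero    y    = bound F 0 y
◂-Fits F G g₀≡f₁ .bound (suc x) y    = bound G x y

module _ (b : ℕ) where

  -- Rows are inserted from the last to the first. Row 0 enters as `f 0`, not as weights: its
  -- entries are already the last passage times, and toggles never change row 0.
  Φ : ℕ → Array → Array
  Φ zero    f = f
  Φ (suc a) f = sweep b (f 0 ◂ Φ a (f ∘ suc))

  Ψ : ℕ → Array → Array
  Ψ zero    f = f
  Ψ (suc a) f = unsweep b f 0 ◂ Ψ a (unsweep b f ∘ suc)

  Φ-row₀ : ∀ a f y → Φ a f 0 y ≡ f 0 y
  Φ-row₀ zero    f y = refl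
  Φ-row₀ (suc a) f y = sweep-row₀ b _ y

  Ψ-row₀ : ∀ a f y → Ψ a f 0 y ≡ f 0 y
  Ψ-row₀ zero    f y = refl
  Ψ-row₀ (suc a) f y = unsweep-row₀ b f y

  Φ-cong : ∀ a {f g} → f ≈ g → Φ a f ≈ Φ a g
  Φ-cong zero    f≈g = f≈g
  Φ-cong (suc a) f≈g = sweep-cong b (◂-cong (f≈g 0) (Φ-cong a (f≈g ∘ suc)))

  Ψ-cong : ∀ a {f g} → f ≈ g → Ψ a f ≈ Ψ a g
  Ψ-cong zero    f≈g = f≈g
  Ψ-cong (suc a) f≈g = ◂-cong (unsweep-cong b f≈g 0) (Ψ-cong a (unsweep-cong b f≈g ∘ suc))

  module _ {c : ℕ} where

    Φ-Fits : ∀ a {f} → Fits a b c f → Fits a b c (Φ a f)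
    ◂Φ-Fits : ∀ a {f} → Fits (suc a) b c f → Fits (suc a) b c (f 0 ◂ Φ a (f ∘ suc))

    Φ-Fits zero    F = F
    Φ-Fits (suc a) F = sweep-Fits b (◂Φ-Fits a F)

    ◂Φ-Fits a F = ◂-Fits F (Φ-Fits a (tail-Fits F)) (Φ-row₀ a _)

    Ψ-Fits : ∀ a {f} → Fits a b c f → Fits a b c (Ψ a f)
    Ψ-Fits zero    F = F
    Ψ-Fits (suc a) F = ◂-Fits F′ (Ψ-Fits a (tail-Fits F′)) (Ψ-row₀ a _)
      where F′ = unsweep-Fits b F

    Ψ-Φ : ∀ a {f} → Fits a b c f → Ψ a (Φ a f) ≈ f
    Ψ-Φ zero    F x y = refl
    Ψ-Φ (suc a) {f} F = λ
      { zero    y → undo 0 y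
      ; (suc x) y → trans (Ψ-cong a (undo ∘ suc) x y) (Ψ-Φ a (tail-Fits F) x y) }
      where
      undo : unsweep b (Φ (suc a) f) ≈ (f 0 ◂ Φ a (f ∘ suc))
      undo = unsweep-sweep b (◂Φ-Fits a F)

    Φ-Ψ : ∀ a {f} → Fits a b c f → Φ a (Ψ a f) ≈ f
    Φ-Ψ zero    F x y = refl
    Φ-Ψ (suc a) {f} F x y = trans (sweep-cong b redo x y) (sweep-unsweep b F x y)
      where
      redo : (unsweep b f 0 ◂ Φ a (Ψ a (unsweep b f ∘ suc))) ≈ unsweep b f
      redo zero    y = refl
      redo (suc x) y = Φ-Ψ a (tail-Fits (unsweep-Fits b F)) x y

-- Diagonal sums and rectangle sums.

diagonal : ℕ → Array → ℕ → ℕ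
diagonal N f q = ∑ N (λ k → f k (k + q))

weight : Array → Array
weight f x y = f x y ∸ (f (suc x) y ⊔ f x (suc y))

-- For `w` vanishing from column `b` on, this is the sum over all columns from `q` on, always with a
-- window of width `b`.
rectangle : ℕ → ℕ → Array → ℕ → ℕ
rectangle a b w q = ∑ a (λ x → ∑ b (λ y → w x (y + q)))

module _ {a b c : ℕ} {f : Array} (F : Fits a b c f) where

  -- The last passage recursion.
  weight+⊔ : ∀ x y → weight f x y + (f (suc x) y ⊔ f x (suc y)) ≡ f x y
  weight+⊔ x y = m∸n+n≡m (⊔-lub (down F x y) (right F x y))

  weight-cols : ∀ x y → b ≤ y → weight f x y ≡ 0
  weight-cols x y le = trans (cong (_∸ (f (suc x) y ⊔ f x (suc y))) (cols F x y le)) (0∸n≡0 (f (suc x) y ⊔ f x (suc y)))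

  diagonal-zero : ∀ N q → b ≤ q → diagonal N f q ≡ 0
  diagonal-zero N q b≤q = ∑-zero N (λ k → cols F k (k + q) (≤-trans b≤q (m≤n+m q k)))

  rectangle-zero : ∀ m q → b ≤ q → rectangle m b (weight f) q ≡ 0
  rectangle-zero m q b≤q = ∑-zero m (λ x → ∑-zero b (λ y → weight-cols x (y + q) (≤-trans b≤q (m≤n+m q y))))

-- The minimum entering a toggled cell and the maximum entering the previous toggled cell
-- are taken over the same two entries, so together they contribute the sum of these entries.
toggled-diagonal : ∀ {a b c h} → Fits (suc a) b c h → ∀ j M → a ≤ M →
  ∑ M (λ k → toggled h k (k + j)) + ∑ M (λ k → h (suc k) (suc (k + j)))
    ≡ (h 0 (suc j) ⊓ h 1 j)
      + (∑ M (λ k → h (suc k) (suc (suc (k + j)))) + ∑ M (λ k → h (suc (suc k)) (suc (k + j))))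
toggled-diagonal {h = h} H j M a≤M = begin
  ∑ M t + ∑ M e                        ≡⟨ ∑-+ M t e ⟨
  ∑ M (λ k → t k + e k)                ≡⟨ ∑-cong M (λ k → toggled+cell H k (k + j)) ⟩
  ∑ M (λ k → lo k + hi k)              ≡⟨ ∑-+ M lo hi ⟩
  ∑ M lo + ∑ M hi                      ≡⟨ cong (_+ ∑ M hi) (∑-tail M lo lo-M) ⟩
  lo 0 + ∑ M (lo ∘ suc) + ∑ M hi       ≡⟨ +-assoc (lo 0) _ _ ⟩
  lo 0 + (∑ M (lo ∘ suc) + ∑ M hi)     ≡⟨ cong (lo 0 +_) (∑-+ M (lo ∘ suc) hi) ⟨
  lo 0 + ∑ M (λ k → lo (suc k) + hi k) ≡⟨ cong (lo 0 +_) (∑-cong M lo+hi) ⟩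
  lo 0 + ∑ M (λ k → u k + v k)         ≡⟨ cong (lo 0 +_) (∑-+ M u v) ⟩
  lo 0 + (∑ M u + ∑ M v)               ∎
  where
  t e lo hi u v : ℕ → ℕ
  t  k = toggled h k (k + j)
  e  k = h (suc k) (suc (k + j))
  lo k = h k (suc (k + j)) ⊓ h (suc k) (k + j)
  hi k = h (suc (suc k)) (suc (k + j)) ⊔ h (suc k) (suc (suc (k + j)))
  u  k = h (suc k) (suc (suc (k + j)))
  v  k = h (suc (suc k)) (suc (k + j))
  lo-M : lo M ≡ 0
  lo-M = trans (cong (h M (suc (M + j)) ⊓_) (rows H (suc M) (M + j) (s≤s a≤M))) (⊓-zeroʳ (h M (suc (M + j))))
  lo+hi : ∀ k → lo (suc k) + hi k ≡ u k + v k
  lo+hi k = trans (cong (lo (suc k) +_) (⊔-comm (v k) (u k))) (⊓+⊔≡+ (u k) (v k))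

-- Diagonal sums while a row is inserted.

module _ {a b c : ℕ} {f g : Array} (F : Fits (suc a) b c f) (g₀≡f₁ : ∀ y → g 0 y ≡ f 1 y)
  (g-diagonal : ∀ N q → a ≤ N → diagonal N g q ≡ rectangle a b (weight (f ∘ suc)) q) where

  private
    R R′ rs : ℕ → ℕ
    R  = rectangle (suc a) b (weight f)
    R′ = rectangle a b (weight (f ∘ suc))
    rs q = ∑ b (λ y → weight f 0 (y + q))

  -- The state in which the diagonals through (0,q) with q ≥ n have been toggled.
  record Swept (n : ℕ) (h : Array) : Set where
    field
      fits         : Fits (suc a) b c h
      row₀         : ∀ y → h 0 y ≡ f 0 y
      untouched    : ∀ x y → y ≤ x + n → h (suc x) y ≡ g x y
      diagonal-sum : ∀ N q → a ≤ N → n ≤ q → diagonal (suc N) h q ≡ R q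

  open Swept

  -- Inclusion-exclusion: the rectangle at `(0,j)` is its corner cell plus the rectangles at
  -- `(0,j+1)` and `(1,j)`, minus their overlap at `(1,j+1)`. The overlap is added to both sides to
  -- avoid subtraction. Of the diagonals involved, only the one at `(0,j+1)` has been toggled
  -- already; the others are still those of `g`.
  Swept-T-diagonal : ∀ j {h} → Swept (suc j) h → ∀ N → a ≤ N → diagonal (suc N) (T j h) j ≡ R j
  Swept-T-diagonal j {h} S N a≤N = +-cancelʳ-≡ (R′ (suc j)) _ _ (begin
    h 0 j + ∑ N (λ k → T j h (suc k) (suc (k + j))) + R′ (suc j)
      ≡⟨ cong₂ (λ p q → p + q + R′ (suc j)) h₀ⱼ (∑-cong N (λ k → T-on j h refl)) ⟩
    w + (f₁ ⊔ f₀) + tog + R′ (suc j)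
      ≡⟨ cong (w + (f₁ ⊔ f₀) + tog +_) diag₁ ⟨
    w + (f₁ ⊔ f₀) + tog + ∑ N (λ k → h (suc k) (suc (k + j)))
      ≡⟨ +-assoc (w + (f₁ ⊔ f₀)) tog _ ⟩
    w + (f₁ ⊔ f₀) + (tog + ∑ N (λ k → h (suc k) (suc (k + j))))
      ≡⟨ cong (w + (f₁ ⊔ f₀) +_) (toggled-diagonal (fits S) j N a≤N) ⟩
    w + (f₁ ⊔ f₀) + ((h 0 (suc j) ⊓ h 1 j) + (∑u + ∑v))
      ≡⟨ cong₂ (λ p q → w + (f₁ ⊔ f₀) + ((p ⊓ q) + (∑u + ∑v))) (row₀ S (suc j)) h₁ⱼ ⟩
    w + (f₁ ⊔ f₀) + ((f₀ ⊓ f₁) + (∑u + ∑v))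
      ≡⟨ regroup w (f₁ ⊔ f₀) (f₀ ⊓ f₁) (∑u + ∑v) ⟩
    w + ((f₀ ⊓ f₁) + (f₁ ⊔ f₀) + (∑u + ∑v))
      -- The one unpaired minimum of the toggled diagonal meets the maximum in the last passage
      -- recursion at `(0,j)`.
      ≡⟨ cong (λ p → w + (p + (∑u + ∑v))) (trans (cong ((f₀ ⊓ f₁) +_) (⊔-comm f₁ f₀)) (⊓+⊔≡+ f₀ f₁)) ⟩
    w + (f₀ + f₁ + (∑u + ∑v))
      ≡⟨ cong (w +_) (interchange f₀ f₁ ∑u ∑v) ⟩
    w + (f₀ + ∑u + (f₁ + ∑v))
      ≡⟨ cong₂ (λ p q → w + (p + q)) diag₀ diag₂ ⟩
    w + (rs (suc j) + R′ (suc j) + R′ j)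
      ≡⟨ regroup′ w (rs (suc j)) (R′ (suc j)) (R′ j) ⟩
    w + rs (suc j) + R′ j + R′ (suc j)
      ≡⟨ cong (λ p → p + R′ j + R′ (suc j)) (∑-shift b j (weight f 0) (weight-cols F 0 (b + j) (m≤m+n b j))) ⟨
    R j + R′ (suc j) ∎)
    where
    w f₀ f₁ tog ∑u ∑v : ℕ
    w   = weight f 0 j
    f₀  = f 0 (suc j)
    f₁  = f 1 j
    tog = ∑ N (λ k → toggled h k (k + j))
    ∑u  = ∑ N (λ k → h (suc k) (suc (suc (k + j))))
    ∑v  = ∑ N (λ k → h (suc (suc k)) (suc (k + j)))

    regroup : ∀ p q r s → p + q + (r + s) ≡ p + (r + q + s)
    regroup = solve-∀

    regroup′ : ∀ p q r s → p + (q + r + s) ≡ p + q + s + r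
    regroup′ = solve-∀

    h₀ⱼ : h 0 j ≡ w + (f₁ ⊔ f₀)
    h₀ⱼ = trans (row₀ S j) (sym (weight+⊔ F 0 j))

    h₁ⱼ : h 1 j ≡ f₁
    h₁ⱼ = trans (untouched S 0 j (n≤1+n j)) (g₀≡f₁ j)

    diag₀ : f₀ + ∑u ≡ R (suc j)
    diag₀ = begin
      f₀ + ∑u
        ≡⟨ cong₂ _+_ (row₀ S (suc j)) (∑-cong N (λ k → cong (h (suc k) ∘ suc) (+-suc k j))) ⟨
      diagonal (suc N) h (suc j)
        ≡⟨ diagonal-sum S N (suc j) a≤N ≤-refl ⟩
      R (suc j) ∎

    diag₁ : ∑ N (λ k → h (suc k) (suc (k + j))) ≡ R′ (suc j)
    diag₁ = begin
      ∑ N (λ k → h (suc k) (suc (k + j)))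
        ≡⟨ ∑-cong N (λ k → trans (cong (h (suc k)) (sym (+-suc k j))) (untouched S k (k + suc j) ≤-refl)) ⟩
      diagonal N g (suc j)
        ≡⟨ g-diagonal N (suc j) a≤N ⟩
      R′ (suc j) ∎

    diag₂ : f₁ + ∑v ≡ R′ j
    diag₂ = begin
      f₁ + ∑v
        ≡⟨ cong₂ _+_ (sym (g₀≡f₁ j)) (∑-cong N (λ k → untouched S (suc k) (suc (k + j)) (s≤s (+-monoʳ-≤ k (n≤1+n j))))) ⟩
      diagonal (suc N) g j
        ≡⟨ g-diagonal (suc N) j (m≤n⇒m≤1+n a≤N) ⟩
      R′ j ∎

  Swept-T : ∀ j {h} → Swept (suc j) h → Swept j (T j h)
  Swept-T j S .fits = T-Fits (fits S) j
  Swept-T j S .row₀ = row₀ S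
  Swept-T j S .untouched x zero    le = untouched S x zero z≤n
  Swept-T j {h} S .untouched x (suc y) le =
    -- In row `suc x`, `T j` changes only column `suc (x + j)`, one past the last untouched column.
    trans (T-off j h (<⇒≢ le)) (untouched S x (suc y) (≤-trans le (+-monoʳ-≤ x (n≤1+n j))))
  Swept-T j {h} S .diagonal-sum N q a≤N j≤q with j ≟ q
  ... | yes refl = Swept-T-diagonal j S N a≤N
  ... | no  j≢q  = trans
    (cong (h 0 q +_) (∑-cong N (λ k → T-off j h (λ eq → j≢q (sym (+-cancelˡ-≡ k q j eq))))))
    (diagonal-sum S N q a≤N (≤∧≢⇒< j≤q j≢q))

  Swept-sweep : ∀ n {h} → Swept n h → Swept 0 (sweep n h)
  Swept-sweep zero    S = S
  Swept-sweep (suc n) S = Swept-sweep n (Swept-T n S)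

  -- Before the sweep only diagonals starting outside the box are claimed, and there both sums
  -- vanish.
  Swept-◂ : Fits a b c g → Swept b (f 0 ◂ g)
  Swept-◂ G .fits = ◂-Fits F G g₀≡f₁
  Swept-◂ G .row₀ y = refl
  Swept-◂ G .untouched x y _ = refl
  Swept-◂ G .diagonal-sum N q _ b≤q =
    trans (diagonal-zero (◂-Fits F G g₀≡f₁) (suc N) q b≤q) (sym (rectangle-zero F (suc a) q b≤q))

module _ {b c : ℕ} where

  -- Induction on rows, mutual with `Φ-Swept`: the diagonal sums of the lower rows drive the sweep
  -- of the first row, and at its end all diagonals starting in row 0 are covered.
  Φ-diagonal : ∀ a {f} → Fits a b c f → ∀ N q → a ≤ N →
    diagonal N (Φ b a f) q ≡ rectangle a b (weight f) q

  Φ-Swept : ∀ a {f} (F : Fits (suc a) b c f) →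
    Swept F (Φ-row₀ b a (f ∘ suc)) (Φ-diagonal a (tail-Fits F)) 0 (Φ b (suc a) f)

  Φ-diagonal zero    F N q _ = ∑-zero N (λ k → rows F k (k + q) z≤n)
  Φ-diagonal (suc a) F (suc N) q (s≤s a≤N) = Swept.diagonal-sum (Φ-Swept a F) N q a≤N z≤n

  Φ-Swept a F = Swept-sweep F _ _ b (Swept-◂ F _ _ (Φ-Fits b a (tail-Fits F)))

-- Volume and trace from the diagonal sums.

-- The diagonals starting in column 0, the main one included; `lowerRectangles` collects the
-- matching rectangle sums.
lowerDiagonals : ℕ → ℕ → Array → ℕ
lowerDiagonals a N f = ∑ a (λ p → ∑ N (λ k → f (p + k) k))

lowerRectangles : ℕ → ℕ → Array → ℕ
lowerRectangles zero    b w = 0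
lowerRectangles (suc a) b w = rectangle (suc a) b w 0 + lowerRectangles a b (w ∘ suc)

mainDiagonal : ∀ N f → ∑ N (λ k → f k k) ≡ diagonal N f 0
mainDiagonal N f = ∑-cong N (λ k → cong (f k) (sym (+-identityʳ k)))

-- Each cell lies on one diagonal, and the main diagonal is counted in both families, hence the
-- extra term on the right.
∑∑-diagonals : ∀ {b c} a {f} → Fits a b c f → ∀ N → a ≤ N →
  ∑ b (diagonal N f) + lowerDiagonals a N f ≡ ∑ a (λ x → ∑ b (f x)) + diagonal N f 0
∑∑-diagonals {b} zero {f} F N _ = begin
  ∑ b (diagonal N f) + 0 ≡⟨ +-identityʳ _ ⟩
  ∑ b (diagonal N f)     ≡⟨ ∑-zero b diagonal≡0 ⟩
  0                      ≡⟨ diagonal≡0 0 ⟨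
  diagonal N f 0         ∎
  where
  diagonal≡0 : ∀ q → diagonal N f q ≡ 0
  diagonal≡0 q = ∑-zero N (λ k → rows F k (k + q) z≤n)
-- Removing row 0 leaves the tails `d 1`, `d 2`, and so on; adding `d 0` to both sides completes the
-- sum in the induction hypothesis.
∑∑-diagonals {b} (suc a) {f} F (suc M) (s≤s a≤M) = +-cancelʳ-≡ (d 0) _ _ (begin
  ∑ b (diagonal (suc M) f) + (∑ (suc M) (λ k → f k k) + l) + d 0
    ≡⟨ cong₂ (λ p q → p + (q + l) + d 0)
         (trans (∑-cong b peel) (∑-+ b (f 0) (d ∘ suc))) (mainDiagonal (suc M) f) ⟩
  ∑ b (f 0) + ∑ b (d ∘ suc) + (D₀ + l) + d 0
    ≡⟨ regroup (∑ b (f 0)) (∑ b (d ∘ suc)) D₀ l (d 0) ⟩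
  ∑ b (f 0) + ((d 0 + ∑ b (d ∘ suc)) + l) + D₀
    ≡⟨ cong (λ p → ∑ b (f 0) + (p + l) + D₀) (∑-tail b d (diagonal-zero F′ (suc M) b ≤-refl)) ⟨
  ∑ b (f 0) + (∑ b d + l) + D₀
    ≡⟨ cong (λ p → ∑ b (f 0) + p + D₀) (∑∑-diagonals a F′ (suc M) (m≤n⇒m≤1+n a≤M)) ⟩
  ∑ b (f 0) + (∑ a (λ x → ∑ b (f (suc x))) + d 0) + D₀
    ≡⟨ regroup′ (∑ b (f 0)) (∑ a (λ x → ∑ b (f (suc x)))) (d 0) D₀ ⟩
  ∑ b (f 0) + ∑ a (λ x → ∑ b (f (suc x))) + D₀ + d 0 ∎)
  where
  F′ = tail-Fits F
  D₀ l : ℕ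
  D₀ = diagonal (suc M) f 0
  l  = lowerDiagonals a (suc M) (f ∘ suc)
  d : ℕ → ℕ
  d = diagonal (suc M) (f ∘ suc)

  regroup : ∀ p q r s t → p + q + (r + s) + t ≡ p + ((t + q) + s) + r
  regroup = solve-∀

  regroup′ : ∀ p q r s → p + (q + r) + s ≡ p + q + s + r
  regroup′ = solve-∀

  peel : ∀ q → diagonal (suc M) f q ≡ f 0 q + d (suc q)
  peel q = cong (f 0 q +_) (begin
    ∑ M (λ k → f (suc k) (suc (k + q)))
      ≡⟨ ∑-cong M (λ k → cong (f (suc k)) (sym (+-suc k q))) ⟩
    diagonal M (f ∘ suc) (suc q)
      ≡⟨ ∑-extend (λ k → f (suc k) (k + suc q)) (λ k M≤k → rows F (suc k) (k + suc q) (s≤s (≤-trans a≤M M≤k))) (n≤1+n M) ⟨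
    d (suc q) ∎)

-- The value `v y` is counted once for each `q ≤ y`. The inner length `N` is separate so that the
-- induction can shrink `b` alone.
∑-tails : ∀ b N (v : ℕ → ℕ) → (∀ y → b ≤ y → v y ≡ 0) → b ≤ N →
  ∑ b (λ q → ∑ N (λ y → v (y + q))) ≡ ∑ b (λ y → v y * suc y)
∑-tails zero    N v v≡0 _   = refl
∑-tails (suc b) N v v≡0 b<N = begin
  ∑ N (λ y → v (y + 0)) + ∑ b (λ q → ∑ N (λ y → v (y + suc q)))
    ≡⟨ cong₂ _+_ (∑-cong N (λ y → cong v (+-identityʳ y)))
         (∑-cong b (λ q → ∑-cong N (λ y → cong v (+-suc y q)))) ⟩
  ∑ N v + ∑ b (λ q → ∑ N (λ y → v (suc (y + q))))
    ≡⟨ cong₂ _+_ (∑-extend v v≡0 b<N) (∑-tails b N (v ∘ suc) (λ y le → v≡0 (suc y) (s≤s le)) (<⇒≤ b<N)) ⟩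
  v 0 + ∑ b (v ∘ suc) + ∑ b (λ y → v (suc y) * suc y)
    ≡⟨ +-assoc (v 0) _ _ ⟩
  v 0 + (∑ b (v ∘ suc) + ∑ b (λ y → v (suc y) * suc y))
    ≡⟨ cong₂ _+_ (sym (*-identityʳ (v 0))) (sym (∑-+ b (v ∘ suc) (λ y → v (suc y) * suc y))) ⟩
  v 0 * 1 + ∑ b (λ y → v (suc y) + v (suc y) * suc y)
    ≡⟨ cong (v 0 * 1 +_) (∑-cong b (λ y → *-suc (v (suc y)) (suc y))) ⟨
  v 0 * 1 + ∑ b (λ y → v (suc y) * suc (suc y)) ∎

-- The cell `(x,y)` lies in `suc y` rectangles of the first family and `suc x` of the second. The
-- full rectangle belongs to both, so one count moves to the right and `suc (x + y)` remain.
∑-rectangles : ∀ a b (w : Array) → (∀ x y → b ≤ y → w x y ≡ 0) →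
  ∑ b (rectangle a b w) + lowerRectangles a b w
    ≡ ∑ a (λ x → ∑ b (λ y → w x y * suc (x + y))) + rectangle a b w 0
∑-rectangles zero    b w w≡0 = trans (+-identityʳ _) (∑-zero b (λ _ → refl))
∑-rectangles (suc a) b w w≡0 = begin
  ∑ b (λ q → rs q + R′ q) + (R₀ + l)
    ≡⟨ cong (_+ (R₀ + l)) (∑-+ b rs R′) ⟩
  ∑ b rs + ∑ b R′ + (R₀ + l)
    ≡⟨ regroup (∑ b rs) (∑ b R′) R₀ l ⟩
  ∑ b rs + (∑ b R′ + l) + R₀
    ≡⟨ cong₂ (λ p q → p + q + R₀) (∑-tails b b (w 0) (w≡0 0) ≤-refl) (∑-rectangles a b (w ∘ suc) (w≡0 ∘ suc)) ⟩
  top + (∑ a moment + R′ 0) + R₀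
    -- Moving down one row raises each multiplicity by one, which `R′ 0` supplies.
    ≡⟨ cong (λ p → top + p + R₀) (trans (+-comm (∑ a moment) (R′ 0)) (sym (trans (∑-cong a lift) (∑-+ a rowSum moment)))) ⟩
  top + ∑ a (λ x → ∑ b (λ y → w (suc x) y * suc (suc (x + y)))) + R₀ ∎
  where
  rs R′ moment rowSum : ℕ → ℕ
  rs q = ∑ b (λ y → w 0 (y + q))
  R′ = rectangle a b (w ∘ suc)
  moment x = ∑ b (λ y → w (suc x) y * suc (x + y))
  rowSum x = ∑ b (λ y → w (suc x) (y + 0))
  R₀ l top : ℕ
  R₀ = rectangle (suc a) b w 0
  l  = lowerRectangles a b (w ∘ suc)
  top = ∑ b (λ y → w 0 y * suc y)

  regroup : ∀ p q r s → p + q + (r + s) ≡ p + (q + s) + r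
  regroup = solve-∀

  lift : ∀ x → ∑ b (λ y → w (suc x) y * suc (suc (x + y))) ≡ rowSum x + moment x
  lift x = trans
    (∑-cong b (λ y → trans (*-suc (w (suc x) y) (suc (x + y)))
      (cong (λ z → w (suc x) z + w (suc x) y * suc (x + y)) (sym (+-identityʳ y)))))
    (∑-+ b (λ y → w (suc x) (y + 0)) (λ y → w (suc x) y * suc (x + y)))

module _ {b c : ℕ} where

  -- A sweep leaves the diagonals starting below row 0 in column 0 untouched, so their sums come
  -- from the earlier insertions.
  Φ-lowerDiagonals : ∀ a {f} → Fits a b c f → ∀ N → a ≤ N →
    lowerDiagonals a N (Φ b a f) ≡ lowerRectangles a b (weight f)
  Φ-lowerDiagonals zero    F N _   = refl
  Φ-lowerDiagonals (suc a) {f} F N a<N = cong₂ _+_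
    (trans (mainDiagonal N (Φ b (suc a) f)) (Φ-diagonal (suc a) F N 0 a<N))
    (trans
      (∑-cong a (λ p → ∑-cong N (λ k → Swept.untouched (Φ-Swept a F) (p + k) k (≤-trans (m≤n+m k p) (m≤m+n (p + k) 0)))))
      (Φ-lowerDiagonals a (tail-Fits F) N (<⇒≤ a<N)))

  Φ-∑∑ : ∀ a {f} → Fits a b c f →
    ∑ a (λ x → ∑ b (Φ b a f x)) ≡ ∑ a (λ x → ∑ b (λ y → weight f x y * suc (x + y)))
  -- The main diagonal and the full rectangle, each counted twice, have equal sums and cancel.
  Φ-∑∑ a {f} F = +-cancelʳ-≡ (rectangle a b (weight f) 0) _ _ (begin
    ∑ a (λ x → ∑ b (Φ b a f x)) + rectangle a b (weight f) 0
      ≡⟨ cong (∑ a (λ x → ∑ b (Φ b a f x)) +_) (Φ-diagonal a F a 0 ≤-refl) ⟨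
    ∑ a (λ x → ∑ b (Φ b a f x)) + diagonal a (Φ b a f) 0
      ≡⟨ ∑∑-diagonals a (Φ-Fits b a F) a ≤-refl ⟨
    ∑ b (diagonal a (Φ b a f)) + lowerDiagonals a a (Φ b a f)
      ≡⟨ cong₂ _+_ (∑-cong b (λ q → Φ-diagonal a F a q ≤-refl)) (Φ-lowerDiagonals a F a ≤-refl) ⟩
    ∑ b (rectangle a b (weight f)) + lowerRectangles a b (weight f)
      ≡⟨ ∑-rectangles a b (weight f) (weight-cols F) ⟩
    ∑ a (λ x → ∑ b (λ y → weight f x y * suc (x + y))) + rectangle a b (weight f) 0 ∎)

  Φ-trace : ∀ a {f} → Fits a b c f →
    ∑ (a ⊓ b) (λ i → Φ b a f i i) ≡ ∑ a (λ x → ∑ b (λ y → weight f x y * 1))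
  Φ-trace a {f} F = begin
    ∑ (a ⊓ b) (λ i → Φ b a f i i)
      ≡⟨ ∑-extend (λ i → Φ b a f i i) outside (m⊓n≤m a b) ⟨
    ∑ a (λ i → Φ b a f i i)
      ≡⟨ mainDiagonal a (Φ b a f) ⟩
    diagonal a (Φ b a f) 0
      ≡⟨ Φ-diagonal a F a 0 ≤-refl ⟩
    rectangle a b (weight f) 0
      ≡⟨ ∑-cong a (λ x → ∑-cong b (λ y → trans (cong (weight f x) (+-identityʳ y)) (sym (*-identityʳ _)))) ⟩
    ∑ a (λ x → ∑ b (λ y → weight f x y * 1)) ∎
    where
    outside : ∀ i → a ⊓ b ≤ i → Φ b a f i i ≡ 0
    outside i le with ⊓-sel a b
    ... | inj₁ eq = rows (Φ-Fits b a F) i i (subst (_≤ i) eq le)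
    ... | inj₂ eq = cols (Φ-Fits b a F) i i (subst (_≤ i) eq le)

-- Corners above a cell.

-- The corners lie at the heights above `d ⊔ r` and up to `e`; the induction lowers all heights by
-- one level at a time.
∑-between : ∀ c e d r x → e ≤ c →
  ∑ c (λ k → if (suc k ≤ᵇ e) ∧ not (suc k ≤ᵇ d) ∧ not (suc k ≤ᵇ r) then x else 0) ≡ (e ∸ (d ⊔ r)) * x
∑-between c       zero    d       r       x _ =
  trans (∑-zero c (λ _ → refl)) (cong (_* x) (sym (0∸n≡0 (d ⊔ r))))
∑-between (suc c) (suc e) zero    zero    x (s≤s le) = cong (x +_) (∑-between c e 0 0 x le)
∑-between (suc c) (suc e) (suc d) zero    x (s≤s le) =
  trans (∑-between c e d 0 x le) (cong (λ m → (e ∸ m) * x) (⊔-identityʳ d))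
∑-between (suc c) (suc e) zero    (suc r) x (s≤s le) = ∑-between c e 0 r x le
∑-between (suc c) (suc e) (suc d) (suc r) x (s≤s le) = ∑-between c e d r x le

-- Matrices and arrays.

vget-outside : ∀ {n} (v : Vec ℕ n) j → n ≤ j → vget v j ≡ 0
vget-outside []      j       _        = refl
vget-outside (_ ∷ v) (suc j) (s≤s le) = vget-outside v j le

vget-replicate : ∀ n j → vget (replicate n 0) j ≡ 0
vget-replicate zero    j       = refl
vget-replicate (suc n) zero    = refl
vget-replicate (suc n) (suc j) = vget-replicate n j

vget-injective : ∀ {n} (v w : Vec ℕ n) → (∀ j → vget v j ≡ vget w j) → v ≡ w
vget-injective []      []      _  = refl
vget-injective (_ ∷ v) (_ ∷ w) eq = cong₂ _∷_ (eq 0) (vget-injective v w (eq ∘ suc))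

vget-tabulate : ∀ n (f : ℕ → ℕ) → (∀ j → n ≤ j → f j ≡ 0) → ∀ j → vget (tabulate {n = n} (f ∘ toℕ)) j ≡ f j
vget-tabulate zero    f f≡0 j       = sym (f≡0 j z≤n)
vget-tabulate (suc n) f f≡0 zero    = refl
vget-tabulate (suc n) f f≡0 (suc j) = vget-tabulate n (f ∘ suc) (λ i le → f≡0 (suc i) (s≤s le)) j

ent-outside-rows : ∀ {a b} (π : Mat a b) i j → a ≤ i → ent π i j ≡ 0
ent-outside-rows {b = b} [] i   j _        = vget-replicate b j
ent-outside-rows (_ ∷ π) (suc i) j (s≤s le) = ent-outside-rows π i j le

ent-outside-cols : ∀ {a b} (π : Mat a b) i j → b ≤ j → ent π i j ≡ 0
ent-outside-cols π i j le = vget-outside (rowget π i) j le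

ent-injective : ∀ {a b} (π ρ : Mat a b) → ent π ≈ ent ρ → π ≡ ρ
ent-injective []      []      _  = refl
ent-injective (r ∷ π) (s ∷ ρ) eq = cong₂ _∷_ (vget-injective r s (eq 0)) (ent-injective π ρ (eq ∘ suc))

toMat : ∀ a b → Array → Mat a b
toMat a b f = tabulate (λ i → tabulate (λ j → f (toℕ i) (toℕ j)))

ent-toMat : ∀ {c} a b {f} → Fits a b c f → ent (toMat a b f) ≈ f
ent-toMat zero    b {f} F i       j = trans (vget-replicate b j) (sym (rows F i j z≤n))
ent-toMat (suc a) b {f} F zero    j = vget-tabulate b (f 0) (cols F 0) j
ent-toMat (suc a) b {f} F (suc i) j = ent-toMat a b (tail-Fits F) i j

module _ {a b c : ℕ} where

  open IsPP

  IsPP⇒Fits : {π : Mat a b} → IsPP c π → Fits a b c (ent π)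
  IsPP⇒Fits {π} P = record
    { down  = everywhere decDown (λ i j a≤i → ent-outside-rows π (suc i) j (m≤n⇒m≤1+n a≤i)) (λ i j → ent-outside-cols π (suc i) j)
    ; right = everywhere decRight (λ i j → ent-outside-rows π i (suc j)) (λ i j b≤j → ent-outside-cols π i (suc j) (m≤n⇒m≤1+n b≤j))
    ; rows  = ent-outside-rows π
    ; cols  = ent-outside-cols π
    ; bound = everywhere bounded (ent-outside-rows π) (ent-outside-cols π)
    }
    where
    -- Inequalities checked in the box extend to all cells, since the smaller side vanishes outside.
    everywhere : {f g : Array} →
      (IsPP c π → All (λ i → All (λ j → f i j ≤ g i j) (upTo b)) (upTo a)) →
      (∀ i j → a ≤ i → f i j ≡ 0) → (∀ i j → b ≤ j → f i j ≡ 0) → ∀ i j → f i j ≤ g i j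
    everywhere {f} {g} inside row col i j with i <? a | j <? b
    ... | no i≮a  | _       = subst (_≤ g i j) (sym (row i j (≮⇒≥ i≮a))) z≤n
    ... | yes _   | no j≮b  = subst (_≤ g i j) (sym (col i j (≮⇒≥ j≮b))) z≤n
    ... | yes i<a | yes j<b = applyUpTo⁻ id b (applyUpTo⁻ id a (inside P) i<a) j<b

  Fits⇒IsPP : {π : Mat a b} → Fits a b c (ent π) → IsPP c π
  Fits⇒IsPP F .bounded  = applyUpTo⁺₂ id a (λ i → applyUpTo⁺₂ id b (λ j → bound F i j))
  Fits⇒IsPP F .decDown  = applyUpTo⁺₂ id a (λ i → applyUpTo⁺₂ id b (λ j → down F i j))
  Fits⇒IsPP F .decRight = applyUpTo⁺₂ id a (λ i → applyUpTo⁺₂ id b (λ j → right F i j))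

  -- Makes a plane partition depend on its entries alone, so the inverse laws can be checked entry
  -- by entry.
  IsPP-irrelevant : {π : Mat a b} (P Q : IsPP c π) → P ≡ Q
  IsPP-irrelevant P Q
    with refl ← All.irrelevant (All.irrelevant ≤-irrelevant) (bounded P) (bounded Q)
       | refl ← All.irrelevant (All.irrelevant ≤-irrelevant) (decDown P) (decDown Q)
       | refl ← All.irrelevant (All.irrelevant ≤-irrelevant) (decRight P) (decRight Q) = refl

  PP-≡ : {π ρ : PP a b c} → ent (proj₁ π) ≈ ent (proj₁ ρ) → π ≡ ρ
  PP-≡ {π , P} {ρ , Q} eq with refl ← ent-injective π ρ eq = cong (π ,_) (IsPP-irrelevant P Q)

  fits-PP : (π : PP a b c) → Fits a b c (ent (proj₁ π))
  fits-PP (_ , P) = IsPP⇒Fits P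

  Fits-resp-≈ : ∀ {f g} → f ≈ g → Fits a b c g → Fits a b c f
  Fits-resp-≈ f≈g G .down  x y    = subst₂ _≤_ (sym (f≈g (suc x) y)) (sym (f≈g x y)) (down G x y)
  Fits-resp-≈ f≈g G .right x y    = subst₂ _≤_ (sym (f≈g x (suc y))) (sym (f≈g x y)) (right G x y)
  Fits-resp-≈ f≈g G .rows  x y le = trans (f≈g x y) (rows G x y le)
  Fits-resp-≈ f≈g G .cols  x y le = trans (f≈g x y) (cols G x y le)
  Fits-resp-≈ f≈g G .bound x y    = subst (_≤ c) (sym (f≈g x y)) (bound G x y)

  fromArray : ∀ {f} → Fits a b c f → PP a b c
  fromArray {f} F = toMat a b f , Fits⇒IsPP (Fits-resp-≈ (ent-toMat a b F) F)

  Φ-PP Ψ-PP : PP a b c → PP a b c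
  Φ-PP π = fromArray (Φ-Fits b a (fits-PP π))
  Ψ-PP π = fromArray (Ψ-Fits b a (fits-PP π))

  ent-Φ-PP : ∀ π → ent (proj₁ (Φ-PP π)) ≈ Φ b a (ent (proj₁ π))
  ent-Φ-PP π = ent-toMat a b (Φ-Fits b a (fits-PP π))

  ent-Ψ-PP : ∀ π → ent (proj₁ (Ψ-PP π)) ≈ Ψ b a (ent (proj₁ π))
  ent-Ψ-PP π = ent-toMat a b (Ψ-Fits b a (fits-PP π))

  Φ-Ψ-PP : ∀ π → Φ-PP (Ψ-PP π) ≡ π
  Φ-Ψ-PP π = PP-≡ λ x y → trans (ent-Φ-PP (Ψ-PP π) x y)
    (trans (Φ-cong b a (ent-Ψ-PP π) x y) (Φ-Ψ b a (fits-PP π) x y))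

  Ψ-Φ-PP : ∀ π → Ψ-PP (Φ-PP π) ≡ π
  Ψ-Φ-PP π = PP-≡ λ x y → trans (ent-Ψ-PP (Φ-PP π) x y)
    (trans (Ψ-cong b a (ent-Φ-PP π) x y) (Ψ-Φ b a (fits-PP π) x y))

  -- Transport of the statistics.

  cornerSum≡∑∑ : ∀ (π : PP a b c) u →
    cornerSum c (proj₁ π) u ≡ ∑ a (λ x → ∑ b (λ y → weight (ent (proj₁ π)) x y * u x y))
  cornerSum≡∑∑ (π , P) u = trans (sumTo≡∑ a _) (∑-cong a λ x → trans (sumTo≡∑ b _) (∑-cong b λ y →
    trans (sumTo≡∑ c _) (∑-between c (ent π x y) (ent π (suc x) y) (ent π x (suc y)) (u x y) (bound (IsPP⇒Fits P) x y))))

  vol-Φ-PP : ∀ π → vol (proj₁ (Φ-PP π)) ≡ chvol c (proj₁ π)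
  vol-Φ-PP π = begin
    vol (proj₁ (Φ-PP π))
      ≡⟨ trans (sumTo≡∑ a _) (∑-cong a λ x → trans (sumTo≡∑ b _) (∑-cong b (ent-Φ-PP π x))) ⟩
    ∑ a (λ x → ∑ b (Φ b a (ent (proj₁ π)) x))
      ≡⟨ Φ-∑∑ a (fits-PP π) ⟩
    ∑ a (λ x → ∑ b (λ y → weight (ent (proj₁ π)) x y * suc (x + y)))
      ≡⟨ cornerSum≡∑∑ π (λ x y → suc (x + y)) ⟨
    chvol c (proj₁ π) ∎

  tr-Φ-PP : ∀ π → tr (proj₁ (Φ-PP π)) ≡ cor c (proj₁ π)
  tr-Φ-PP π = begin
    tr (proj₁ (Φ-PP π))
      ≡⟨ trans (sumTo≡∑ (a ⊓ b) _) (∑-cong (a ⊓ b) λ i → ent-Φ-PP π i i) ⟩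
    ∑ (a ⊓ b) (λ i → Φ b a (ent (proj₁ π)) i i)
      ≡⟨ Φ-trace a (fits-PP π) ⟩
    ∑ a (λ x → ∑ b (λ y → weight (ent (proj₁ π)) x y * 1))
      ≡⟨ cornerSum≡∑∑ π (λ _ _ → 1) ⟨
    cor c (proj₁ π) ∎

Σ-≡ : ∀ {A : Set} {s t : A → ℕ} {n k} {p q : Σ A (λ x → s x ≡ n × t x ≡ k)} → proj₁ p ≡ proj₁ q → p ≡ q
Σ-≡ {p = x , e , e′} {q = .x , d , d′} refl = cong₂ (λ u v → x , u , v) (≡-irrelevant e d) (≡-irrelevant e′ d′)

theorem1p1 : (a b c : ℕ) → 1 ≤ a → 1 ≤ b → 1 ≤ c → (n k : ℕ) →
    (Σ (PP a b c) (λ π → vol (proj₁ π) ≡ n × tr (proj₁ π) ≡ k))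
    ↔ (Σ (PP a b c) (λ π → chvol c (proj₁ π) ≡ n × cor c (proj₁ π) ≡ k))
theorem1p1 a b c _ _ _ n k = mk↔ₛ′
  -- `Φ-PP` turns corner statistics into volume and trace, so the map from left to right is its
  -- inverse.
  (λ (π , v , t) → Ψ-PP π ,
    trans (sym (vol-Φ-PP (Ψ-PP π))) (trans (cong (vol ∘ proj₁) (Φ-Ψ-PP π)) v) ,
    trans (sym (tr-Φ-PP (Ψ-PP π))) (trans (cong (tr ∘ proj₁) (Φ-Ψ-PP π)) t))
  (λ (π , v , t) → Φ-PP π , trans (vol-Φ-PP π) v , trans (tr-Φ-PP π) t)
  (λ (π , _) → Σ-≡ (Ψ-Φ-PP π))
  (λ (π , _) → Σ-≡ (Φ-Ψ-PP π))
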